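{- For all integers $n\ge 0$ and $k\ge 1$, $$F(n+2k;\,n,\,0)=\sum_{s=1}^{k}\sum_{t=0}^{s}\frac{s-t+1}{n+2}\binom{n+2}{s+1}\binom{n+2}{t}F(2k-1;\,2s-1,\,s-t).$$
   Context: For integers $m\ge 0$ and $n_1,n_2$, $F(m;n_1,n_2)$ denotes the number of Gessel walks with exactly $m$ steps from $(0,0)$ to $(n_1,n_2)$: lattice walks starting at the origin, each of whose $m$ steps is one of West $(-1,0)$, North-East $(1,1)$, East $(1,0)$, South-West $(-1,-1)$, and which remain in the first quadrant $\{(i,j): i\ge 0, j\ge 0\}$. In particular $F(m;n_1,n_2)=0$ if $n_1<0$ or $n_2<0$, and $F(0;n_1,n_2)=1$ if $n_1=n_2=0$ and $0$ otherwise. Binomial coefficients $\binom{a}{b}$ with $a\ge 0$ are $0$ when $b>a$. -}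

module Defs where

open import Data.Integer as ℤ using (ℤ; +_; 0ℤ; 1ℤ; -1ℤ)
import Data.Integer.Properties as ℤ
open import Data.List using (List; []; _∷_; [_]; applyUpTo; cartesianProductWith; filter; foldr; length)
open import Data.Nat using (ℕ; zero; suc; _+_; _∸_)
open import Data.Product using (_×_; _,_)
open import Data.Product.Properties using (≡-dec)
open import Data.Rational as ℚ using (ℚ; 0ℚ)
open import Data.Vec as Vec using (Vec)
open import Relation.Binary.PropositionalEquality using (_≡_)
open import Relation.Nullary using (Dec)
open import Relation.Nullary.Decidable using (_×-dec_)

Point : Set
Point = ℤ × ℤ

data Step : Set where
  W NE E SW : Step

displacement : Step → Point
displacement W  = -1ℤ , 0ℤ
displacement NE = 1ℤ , 1ℤ
displacement E  = 1ℤ , 0ℤ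
displacement SW = -1ℤ , -1ℤ

move : Point → Step → Point
move (i , j) s with displacement s
... | di , dj = i ℤ.+ di , j ℤ.+ dj

InQuadrant : Point → Set
InQuadrant (i , j) = 0ℤ ℤ.≤ i × 0ℤ ℤ.≤ j

-- Every point visited from p on, both ends included, lies in the quadrant.
StaysInQuadrant : ∀ {m} → Point → Vec Step m → Set
StaysInQuadrant p Vec.[]       = InQuadrant p
StaysInQuadrant p (s Vec.∷ ss) = InQuadrant p × StaysInQuadrant (move p s) ss

endpoint : ∀ {m} → Point → Vec Step m → Point
endpoint p Vec.[]       = p
endpoint p (s Vec.∷ ss) = endpoint (move p s) ss

origin : Point
origin = 0ℤ , 0ℤ

IsGesselWalk : ∀ {m} → ℤ → ℤ → Vec Step m → Set
IsGesselWalk n₁ n₂ ss = StaysInQuadrant origin ss × endpoint origin ss ≡ (n₁ , n₂)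

inQuadrant? : ∀ p → Dec (InQuadrant p)
inQuadrant? (i , j) = (0ℤ ℤ.≤? i) ×-dec (0ℤ ℤ.≤? j)

staysInQuadrant? : ∀ {m} p (ss : Vec Step m) → Dec (StaysInQuadrant p ss)
staysInQuadrant? p Vec.[]       = inQuadrant? p
staysInQuadrant? p (s Vec.∷ ss) = inQuadrant? p ×-dec staysInQuadrant? (move p s) ss

isGesselWalk? : ∀ {m} n₁ n₂ (ss : Vec Step m) → Dec (IsGesselWalk n₁ n₂ ss)
isGesselWalk? n₁ n₂ ss =
  staysInQuadrant? origin ss ×-dec ≡-dec ℤ._≟_ ℤ._≟_ (endpoint origin ss) (n₁ , n₂)

-- All 4 ^ m step sequences of length m, each occurring once.
stepSequences : ∀ m → List (Vec Step m)
stepSequences zero    = [ Vec.[] ]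
stepSequences (suc m) =
  cartesianProductWith Vec._∷_ (W ∷ NE ∷ E ∷ SW ∷ []) (stepSequences m)

F : ℕ → ℤ → ℤ → ℕ
F m n₁ n₂ = length (filter (isGesselWalk? n₁ n₂) (stepSequences m))

fromℕ : ℕ → ℚ
fromℕ n = + n ℚ./ 1

-- Both bounds are included; the sum is empty when b < a.
sumFromTo : ℕ → ℕ → (ℕ → ℚ) → ℚ
sumFromTo a b f = foldr ℚ._+_ 0ℚ (applyUpTo (λ i → f (a + i)) (suc b ∸ a))

infixr 5 sumFromTo
syntax sumFromTo a b (λ i → e) = ∑[ i from a to b ] e

{-# OPTIONS --safe #-}

-- Cut a walk of length n + 2k after its first 2k − 1 steps, at a point
-- (2s − 1 , y).  To reach (n , 0), the last n + 1 steps must contain exactly s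
-- leftward ones (W or SW), so the abscissa stays ≥ s − 1 ≥ 0 by itself and only
-- the condition on the ordinate matters.  The ordinate performs a ballot-like
-- walk whose count is a 2 × 2 determinant of binomials (reflection), and that
-- determinant, with t = s − y, is the coefficient in the formula.
module Submission where

open import Defs
open import Data.Bool using (true; false; if_then_else_; _∧_)
open import Data.Bool.Properties using (if-idem-then; if-eta)
open import Data.Integer as ℤ using (ℤ; +_; -[1+_]; 0ℤ; 1ℤ; -1ℤ; +≤+; -≤+; -≤-)
import Data.Integer.Properties as ℤ
open import Data.Integer.Tactic.RingSolver using (solve-∀)
open import Data.List using (List; []; _∷_; _++_; map; filter; length; foldr; applyUpTo)
import Data.List.Properties as List
import Data.List.Relation.Unary.All as All
open import Data.Nat using (ℕ; zero; suc; _+_; _*_; _∸_; _≤_; _<_; z≤n; s≤s)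
open import Data.Nat.Combinatorics using (_C_; nCk+nC[k+1]≡[n+1]C[k+1])
import Data.Nat.Properties as ℕ
open import Data.Product using (_×_; _,_; proj₁; proj₂)
open import Data.Product.Properties using (≡-dec)
open import Data.Rational as ℚ using (ℚ; _/_)
import Data.Rational.Properties as ℚ
open import Data.Rational.Unnormalised as ℚᵘ using (mkℚᵘ; *≡*)
import Data.Rational.Unnormalised.Properties as ℚᵘ
open import Data.Sum using (inj₁; inj₂)
open import Data.Vec as Vec using (Vec)
open import Relation.Binary.PropositionalEquality
  using (_≡_; _≢_; refl; sym; trans; cong; cong₂; subst; module ≡-Reasoning)
open import Relation.Nullary using (¬_; Dec; yes; no; does; contradiction)
open import Relation.Nullary.Decidable using (_×-dec_; dec-true; dec-false)

open ≡-Reasoning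

-- Shift identities for integers.

i+1-1≡i : ∀ i → i ℤ.+ 1ℤ ℤ.- 1ℤ ≡ i
i+1-1≡i = solve-∀

i-1+1≡i : ∀ i → i ℤ.- 1ℤ ℤ.+ 1ℤ ≡ i
i-1+1≡i = solve-∀

i-[i-j]≡j : ∀ i j → i ℤ.- (i ℤ.- j) ≡ j
i-[i-j]≡j = solve-∀

i-[j+1]≡i-j-1 : ∀ i j → i ℤ.- (j ℤ.+ 1ℤ) ≡ i ℤ.- j ℤ.- 1ℤ
i-[j+1]≡i-j-1 = solve-∀

i-1-j≡i-j-1 : ∀ i j → i ℤ.- 1ℤ ℤ.- j ≡ i ℤ.- j ℤ.- 1ℤ
i-1-j≡i-j-1 = solve-∀

[i-1]-[j-1]≡i-j : ∀ i j → i ℤ.- 1ℤ ℤ.- (j ℤ.- 1ℤ) ≡ i ℤ.- j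
[i-1]-[j-1]≡i-j = solve-∀

i-[1+i+j]≡-[1+j] : ∀ i j → i ℤ.- (1ℤ ℤ.+ i ℤ.+ j) ≡ ℤ.- (1ℤ ℤ.+ j)
i-[1+i+j]≡-[1+j] = solve-∀

-- Binomial coefficients with an integer lower index.

-- With the value 0 at negative lower indices, Pascal's rule and absorption hold at every integer,
-- so shifts such as `s ℤ.- y ℤ.- 1ℤ` need no side conditions.
binom : ℕ → ℤ → ℤ
binom n (+ k)    = + (n C k)
binom n -[1+ _ ] = 0ℤ

pascal : ∀ n i → binom (suc n) i ≡ binom n i ℤ.+ binom n (i ℤ.- 1ℤ)
pascal n (+ zero)  = refl
pascal n (+ suc k) = cong +_ (begin
  suc n C suc k      ≡⟨ nCk+nC[k+1]≡[n+1]C[k+1] n k ⟨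
  n C k + n C suc k  ≡⟨ ℕ.+-comm (n C k) (n C suc k) ⟩
  n C suc k + n C k  ∎)
pascal n -[1+ _ ]  = refl

absorption : ∀ n i → i ℤ.* binom (suc n) i ≡ + suc n ℤ.* binom n (i ℤ.- 1ℤ)
absorption zero (+ zero) = refl
absorption zero (+ suc zero) = refl
absorption zero (+ suc (suc k)) = ℤ.*-zeroʳ (+ suc (suc k))
absorption zero -[1+ k ] = ℤ.*-zeroʳ -[1+ k ]
absorption (suc n) i = begin
  i ℤ.* binom (suc (suc n)) i
    ≡⟨ cong (i ℤ.*_) (pascal (suc n) i) ⟩
  i ℤ.* (binom (suc n) i ℤ.+ c)
    -- `i * c` becomes `(i - 1) * c + c`, so that the induction hypothesis applies to both products.
    ≡⟨ split i (binom (suc n) i) c ⟩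
  i ℤ.* binom (suc n) i ℤ.+ (j ℤ.* c ℤ.+ c)
    ≡⟨ cong₂ (λ u v → u ℤ.+ (v ℤ.+ c)) (absorption n i) (absorption n j) ⟩
  + suc n ℤ.* binom n j ℤ.+ (+ suc n ℤ.* binom n (j ℤ.- 1ℤ) ℤ.+ c)
    ≡⟨ collect (+ suc n) (binom n j) (binom n (j ℤ.- 1ℤ)) c ⟩
  + suc n ℤ.* (binom n j ℤ.+ binom n (j ℤ.- 1ℤ)) ℤ.+ c
    ≡⟨ cong (λ u → + suc n ℤ.* u ℤ.+ c) (pascal n j) ⟨
  + suc n ℤ.* c ℤ.+ c
    ≡⟨ bump (+ suc n) c ⟩
  + suc (suc n) ℤ.* c ∎
  where
  j = i ℤ.- 1ℤ
  c = binom (suc n) j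
  split : ∀ i b c → i ℤ.* (b ℤ.+ c) ≡ i ℤ.* b ℤ.+ ((i ℤ.- 1ℤ) ℤ.* c ℤ.+ c)
  split = solve-∀
  collect : ∀ m a b c → m ℤ.* a ℤ.+ (m ℤ.* b ℤ.+ c) ≡ m ℤ.* (a ℤ.+ b) ℤ.+ c
  collect = solve-∀
  bump : ∀ m c → m ℤ.* c ℤ.+ c ≡ (1ℤ ℤ.+ m) ℤ.* c
  bump = solve-∀

-- Ballot determinants.

-- By the reflection principle, the number of sequences of N steps, s of them
-- leftward, that go from height y to height 0 without going below height 0.
ballot : ℕ → ℤ → ℤ → ℤ
ballot N s y =
  binom N s ℤ.* binom N (s ℤ.- y) ℤ.- binom N (s ℤ.+ 1ℤ) ℤ.* binom N (s ℤ.- y ℤ.- 1ℤ)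

-- The recursion by first step, in the order `W`, `NE`, `E`, `SW`: a leftward step uses up one of
-- the `s`. Pascal's rule expands the two products into eight terms in six distinct binomials, and
-- these are the eight terms of the four smaller determinants.
ballot-step : ∀ N s y → ballot (suc N) s y ≡
  ballot N (s ℤ.- 1ℤ) y ℤ.+ (ballot N s (y ℤ.+ 1ℤ) ℤ.+
    (ballot N s y ℤ.+ ballot N (s ℤ.- 1ℤ) (y ℤ.- 1ℤ)))
ballot-step N s y
  rewrite pascal N s | pascal N (s ℤ.- y) | pascal N (s ℤ.+ 1ℤ) | pascal N (s ℤ.- y ℤ.- 1ℤ)
        | i+1-1≡i s | i-1+1≡i s
        | i-[j+1]≡i-j-1 s y | i-1-j≡i-j-1 s y | [i-1]-[j-1]≡i-j s y =
  alg (c s) (c (s ℤ.- 1ℤ)) (c (s ℤ.+ 1ℤ))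
      (c (s ℤ.- y)) (c (s ℤ.- y ℤ.- 1ℤ)) (c (s ℤ.- y ℤ.- 1ℤ ℤ.- 1ℤ))
  where
  c = binom N
  alg : ∀ a b d p q r →
    (a ℤ.+ b) ℤ.* (p ℤ.+ q) ℤ.- (d ℤ.+ a) ℤ.* (q ℤ.+ r) ≡
    (b ℤ.* q ℤ.- a ℤ.* r) ℤ.+ ((a ℤ.* q ℤ.- d ℤ.* r) ℤ.+
      ((a ℤ.* p ℤ.- d ℤ.* q) ℤ.+ (b ℤ.* p ℤ.- a ℤ.* q)))
  alg = solve-∀

-- Absorption replaces `suc N` times `binom N s` and `suc N` times `binom N (t ℤ.- 1ℤ)` by multiples
-- of `A` and `B`, with multipliers `s + 1` and `t`; their difference is the numerator of the
-- fraction in the formula.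
ballot-closed : ∀ N s t → + suc N ℤ.* ballot N s (s ℤ.- t) ≡
  (s ℤ.- t ℤ.+ 1ℤ) ℤ.* binom (suc N) (s ℤ.+ 1ℤ) ℤ.* binom (suc N) t
ballot-closed N s t
  rewrite i-[i-j]≡j s t = begin
  n ℤ.* (a ℤ.* c t ℤ.- c (s ℤ.+ 1ℤ) ℤ.* b)
    -- Adding and subtracting `n * a * b` completes a Pascal sum in each product.
    ≡⟨ alg₁ n a b (c t) (c (s ℤ.+ 1ℤ)) ⟩
  (n ℤ.* a) ℤ.* (c t ℤ.+ b) ℤ.- (c (s ℤ.+ 1ℤ) ℤ.+ a) ℤ.* (n ℤ.* b)
    ≡⟨ cong₂ (λ u v → (n ℤ.* a) ℤ.* u ℤ.- v ℤ.* (n ℤ.* b)) (pascal N t) pascal-s ⟨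
  (n ℤ.* a) ℤ.* B ℤ.- A ℤ.* (n ℤ.* b)
    ≡⟨ cong₂ (λ u v → u ℤ.* B ℤ.- A ℤ.* v) absorption-s (absorption N t) ⟨
  ((s ℤ.+ 1ℤ) ℤ.* A) ℤ.* B ℤ.- A ℤ.* (t ℤ.* B)
    ≡⟨ alg₂ s t A B ⟩
  (s ℤ.- t ℤ.+ 1ℤ) ℤ.* A ℤ.* B ∎
  where
  c = binom N
  n = + suc N
  a = c s
  b = c (t ℤ.- 1ℤ)
  A = binom (suc N) (s ℤ.+ 1ℤ)
  B = binom (suc N) t
  pascal-s : A ≡ c (s ℤ.+ 1ℤ) ℤ.+ a
  pascal-s = trans (pascal N (s ℤ.+ 1ℤ)) (cong (λ u → c (s ℤ.+ 1ℤ) ℤ.+ c u) (i+1-1≡i s))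
  absorption-s : (s ℤ.+ 1ℤ) ℤ.* A ≡ n ℤ.* a
  absorption-s = trans (absorption N (s ℤ.+ 1ℤ)) (cong (λ u → n ℤ.* c u) (i+1-1≡i s))
  alg₁ : ∀ n a b p d → n ℤ.* (a ℤ.* p ℤ.- d ℤ.* b) ≡
    (n ℤ.* a) ℤ.* (p ℤ.+ b) ℤ.- (d ℤ.+ a) ℤ.* (n ℤ.* b)
  alg₁ = solve-∀
  alg₂ : ∀ s t A B → ((s ℤ.+ 1ℤ) ℤ.* A) ℤ.* B ℤ.- A ℤ.* (t ℤ.* B) ≡
    (s ℤ.- t ℤ.+ 1ℤ) ℤ.* A ℤ.* B
  alg₂ = solve-∀

-- At height -1 the reflected product equals the direct one. This is the boundary condition just
-- outside the quadrant.
ballot-below : ∀ N s → ballot N s -1ℤ ≡ 0ℤ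
ballot-below N s rewrite i+1-1≡i s = alg (binom N s) (binom N (s ℤ.+ 1ℤ))
  where
  alg : ∀ a b → a ℤ.* b ℤ.- b ℤ.* a ≡ 0ℤ
  alg = solve-∀

-- Each product has a factor with negative lower index. In the second product it is the one at
-- `s - y - 1`, because `s + 1` is 0 when `k` is 0.
ballot-neg : ∀ N k y → ballot N -[1+ k ] (+ y) ≡ 0ℤ
ballot-neg N k zero    = cong (λ u → 0ℤ ℤ.- u) (ℤ.*-zeroʳ (binom N (-[1+ k ] ℤ.+ 1ℤ)))
ballot-neg N k (suc y) = cong (λ u → 0ℤ ℤ.- u) (ℤ.*-zeroʳ (binom N (-[1+ k ] ℤ.+ 1ℤ)))

-- Only `SW` descends, and it is leftward, so `s` leftward steps descend by at most `s`. In the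
-- determinant, `s - y` and `s - y - 1` are both negative.
ballot-high : ∀ N s d → ballot N (+ s) (+ (suc s + d)) ≡ 0ℤ
ballot-high N s d rewrite i-[1+i+j]≡-[1+j] (+ s) (+ d) = begin
  a ℤ.* binom N (ℤ.- + suc d) ℤ.- b ℤ.* binom N (ℤ.- + suc d ℤ.- 1ℤ)
    ≡⟨ cong₂ ℤ._-_ (ℤ.*-zeroʳ a) (ℤ.*-zeroʳ b) ⟩
  0ℤ ∎
  where
  a = binom N (+ s)
  b = binom N (+ s ℤ.+ 1ℤ)

-- Sums over walks in the quadrant.

stepSum : (Step → ℤ) → ℤ
stepSum h = h W ℤ.+ (h NE ℤ.+ (h E ℤ.+ h SW))

onQuadrant : Point → ℤ → ℤ
onQuadrant p v = if does (inQuadrant? p) then v else 0ℤ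

-- The sum of g over the endpoints of the m-step walks from p in the quadrant.
walkSum : ℕ → (Point → ℤ) → Point → ℤ
walkSum zero    g p = onQuadrant p (g p)
walkSum (suc m) g p = onQuadrant p (stepSum λ s → walkSum m g (move p s))

_≟ᴾ_ : (p q : Point) → Dec (p ≡ q)
_≟ᴾ_ = ≡-dec ℤ._≟_ ℤ._≟_

δ : Point → Point → ℤ
δ q p = if does (p ≟ᴾ q) then 1ℤ else 0ℤ

δ-refl : ∀ p → δ p p ≡ 1ℤ
δ-refl p rewrite dec-true (p ≟ᴾ p) refl = refl

δ-≢ : ∀ p q → p ≢ q → δ q p ≡ 0ℤ
δ-≢ p q p≢q = cong (if_then 1ℤ else 0ℤ) (dec-false (p ≟ᴾ q) p≢q)

onQuadrant-inside : ∀ p {v} → InQuadrant p → onQuadrant p v ≡ v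
onQuadrant-inside p {v} p∈Q = cong (if_then v else 0ℤ) (dec-true (inQuadrant? p) p∈Q)

onQuadrant-outside : ∀ p {v} → ¬ InQuadrant p → onQuadrant p v ≡ 0ℤ
onQuadrant-outside p {v} p∉Q = cong (if_then v else 0ℤ) (dec-false (inQuadrant? p) p∉Q)

onQuadrant-cong : ∀ p {v w} → (InQuadrant p → v ≡ w) → onQuadrant p v ≡ onQuadrant p w
onQuadrant-cong p eq with inQuadrant? p
... | yes p∈Q = cong (onQuadrant p) (eq p∈Q)
... | no  p∉Q = trans (onQuadrant-outside p p∉Q) (sym (onQuadrant-outside p p∉Q))

walkSum-outside : ∀ m {g} p → ¬ InQuadrant p → walkSum m g p ≡ 0ℤ
walkSum-outside zero    p = onQuadrant-outside p
walkSum-outside (suc m) p = onQuadrant-outside p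

stepSum-cong : ∀ {g h} → (∀ s → g s ≡ h s) → stepSum g ≡ stepSum h
stepSum-cong eq = cong₂ ℤ._+_ (eq W) (cong₂ ℤ._+_ (eq NE) (cong₂ ℤ._+_ (eq E) (eq SW)))

walkSum-++ : ∀ a b g p → walkSum (a + b) g p ≡ walkSum a (walkSum b g) p
-- The cut point is tested twice, as the end of the first piece and as the start of the second.
-- Splitting on the length of the second piece exposes its test.
walkSum-++ zero    zero    g p = sym (if-idem-then (does (inQuadrant? p)))
walkSum-++ zero    (suc b) g p = sym (if-idem-then (does (inQuadrant? p)))
walkSum-++ (suc a) b       g p = cong (onQuadrant p)
  (stepSum-cong (λ s → walkSum-++ a b g (move p s)))

-- l is the number of leftward steps of a walk from p to q.
walkSum-cong : ∀ m {g h} p →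
  (∀ l q → InQuadrant q → proj₁ q ≡ proj₁ p ℤ.+ + m ℤ.- (+ l ℤ.+ + l) → g q ≡ h q) →
  walkSum m g p ≡ walkSum m h p
walkSum-cong zero p eq = onQuadrant-cong p (λ p∈Q → eq 0 p p∈Q (alg (proj₁ p)))
  where
  alg : ∀ x → x ≡ x ℤ.+ 0ℤ ℤ.- 0ℤ
  alg = solve-∀
walkSum-cong (suc m) {g} {h} p eq = cong (onQuadrant p) (stepSum-cong step)
  where
  x = proj₁ p
  leftwards : ∀ x m l → x ℤ.- 1ℤ ℤ.+ m ℤ.- (l ℤ.+ l) ≡
    x ℤ.+ (1ℤ ℤ.+ m) ℤ.- ((1ℤ ℤ.+ l) ℤ.+ (1ℤ ℤ.+ l))
  leftwards = solve-∀
  rightwards : ∀ x m l → x ℤ.+ 1ℤ ℤ.+ m ℤ.- (l ℤ.+ l) ≡ x ℤ.+ (1ℤ ℤ.+ m) ℤ.- (l ℤ.+ l)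
  rightwards = solve-∀
  left : ∀ s → proj₁ (move p s) ≡ x ℤ.- 1ℤ → walkSum m g (move p s) ≡ walkSum m h (move p s)
  left s sx = walkSum-cong m (move p s) λ l q q∈Q qx → eq (suc l) q q∈Q (begin
    proj₁ q                                             ≡⟨ qx ⟩
    proj₁ (move p s) ℤ.+ + m ℤ.- (+ l ℤ.+ + l)          ≡⟨ cong (λ u → u ℤ.+ + m ℤ.- (+ l ℤ.+ + l)) sx ⟩
    x ℤ.- 1ℤ ℤ.+ + m ℤ.- (+ l ℤ.+ + l)                  ≡⟨ leftwards x (+ m) (+ l) ⟩
    x ℤ.+ + suc m ℤ.- (+ suc l ℤ.+ + suc l)             ∎)
  right : ∀ s → proj₁ (move p s) ≡ x ℤ.+ 1ℤ → walkSum m g (move p s) ≡ walkSum m h (move p s)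
  right s sx = walkSum-cong m (move p s) λ l q q∈Q qx → eq l q q∈Q (begin
    proj₁ q                                             ≡⟨ qx ⟩
    proj₁ (move p s) ℤ.+ + m ℤ.- (+ l ℤ.+ + l)          ≡⟨ cong (λ u → u ℤ.+ + m ℤ.- (+ l ℤ.+ + l)) sx ⟩
    x ℤ.+ 1ℤ ℤ.+ + m ℤ.- (+ l ℤ.+ + l)                  ≡⟨ rightwards x (+ m) (+ l) ⟩
    x ℤ.+ + suc m ℤ.- (+ l ℤ.+ + l)                     ∎)
  step : ∀ s → walkSum m g (move p s) ≡ walkSum m h (move p s)
  step W  = left W refl
  step NE = right NE refl
  step E  = right E refl
  step SW = left SW refl

walkSum-0 : ∀ m p → walkSum m (λ _ → 0ℤ) p ≡ 0ℤ
walkSum-0 zero    p = if-eta (does (inQuadrant? p))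
walkSum-0 (suc m) p = trans
  (cong (onQuadrant p) (stepSum-cong (λ s → walkSum-0 m (move p s))))
  (if-eta (does (inQuadrant? p)))

onQuadrant-+ : ∀ p v w → onQuadrant p (v ℤ.+ w) ≡ onQuadrant p v ℤ.+ onQuadrant p w
onQuadrant-+ p v w with does (inQuadrant? p)
... | true  = refl
... | false = refl

walkSum-+ : ∀ m g h p → walkSum m (λ q → g q ℤ.+ h q) p ≡ walkSum m g p ℤ.+ walkSum m h p
walkSum-+ zero    g h p = onQuadrant-+ p (g p) (h p)
walkSum-+ (suc m) g h p = begin
  onQuadrant p (stepSum λ s → walkSum m (λ q → g q ℤ.+ h q) (move p s))
    ≡⟨ cong (onQuadrant p) (stepSum-cong (λ s → walkSum-+ m g h (move p s))) ⟩
  onQuadrant p (stepSum λ s → walkSum m g (move p s) ℤ.+ walkSum m h (move p s))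
    ≡⟨ cong (onQuadrant p) (alg (f g W) (f g NE) (f g E) (f g SW) (f h W) (f h NE) (f h E) (f h SW)) ⟩
  onQuadrant p (stepSum (λ s → walkSum m g (move p s)) ℤ.+ stepSum (λ s → walkSum m h (move p s)))
    ≡⟨ onQuadrant-+ p _ _ ⟩
  walkSum (suc m) g p ℤ.+ walkSum (suc m) h p ∎
  where
  f : (Point → ℤ) → Step → ℤ
  f g s = walkSum m g (move p s)
  alg : ∀ a b c d a′ b′ c′ d′ →
    (a ℤ.+ a′) ℤ.+ ((b ℤ.+ b′) ℤ.+ ((c ℤ.+ c′) ℤ.+ (d ℤ.+ d′))) ≡
    (a ℤ.+ (b ℤ.+ (c ℤ.+ d))) ℤ.+ (a′ ℤ.+ (b′ ℤ.+ (c′ ℤ.+ d′)))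
  alg = solve-∀

onQuadrant-* : ∀ p c v → onQuadrant p (c ℤ.* v) ≡ c ℤ.* onQuadrant p v
onQuadrant-* p c v with does (inQuadrant? p)
... | true  = refl
... | false = sym (ℤ.*-zeroʳ c)

walkSum-* : ∀ m c g p → walkSum m (λ q → c ℤ.* g q) p ≡ c ℤ.* walkSum m g p
walkSum-* zero    c g p = onQuadrant-* p c (g p)
walkSum-* (suc m) c g p = begin
  onQuadrant p (stepSum λ s → walkSum m (λ q → c ℤ.* g q) (move p s))
    ≡⟨ cong (onQuadrant p) (stepSum-cong (λ s → walkSum-* m c g (move p s))) ⟩
  onQuadrant p (stepSum λ s → c ℤ.* walkSum m g (move p s))
    ≡⟨ cong (onQuadrant p) (alg c (f W) (f NE) (f E) (f SW)) ⟩
  onQuadrant p (c ℤ.* stepSum (λ s → walkSum m g (move p s)))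
    ≡⟨ onQuadrant-* p c _ ⟩
  c ℤ.* walkSum (suc m) g p ∎
  where
  f : Step → ℤ
  f s = walkSum m g (move p s)
  alg : ∀ z a b c d → z ℤ.* a ℤ.+ (z ℤ.* b ℤ.+ (z ℤ.* c ℤ.+ z ℤ.* d)) ≡
    z ℤ.* (a ℤ.+ (b ℤ.+ (c ℤ.+ d)))
  alg = solve-∀

-- Finite sums of integers.

∑< : ℕ → (ℕ → ℤ) → ℤ
∑< zero    f = 0ℤ
∑< (suc n) f = f 0 ℤ.+ ∑< n (λ i → f (suc i))

∑<-cong : ∀ n {f g} → (∀ i → f i ≡ g i) → ∑< n f ≡ ∑< n g
∑<-cong zero    eq = refl
∑<-cong (suc n) eq = cong₂ ℤ._+_ (eq 0) (∑<-cong n (λ i → eq (suc i)))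

∑<-0 : ∀ n {f} → (∀ i → f i ≡ 0ℤ) → ∑< n f ≡ 0ℤ
∑<-0 zero    eq = refl
∑<-0 (suc n) eq = cong₂ ℤ._+_ (eq 0) (∑<-0 n (λ i → eq (suc i)))

∑<-single : ∀ {n i₀ f} → i₀ < n → (∀ i → i ≢ i₀ → f i ≡ 0ℤ) → ∑< n f ≡ f i₀
∑<-single {suc n} {zero} {f} _ eq = begin
  f 0 ℤ.+ ∑< n (λ i → f (suc i)) ≡⟨ cong (λ u → f 0 ℤ.+ u) (∑<-0 n (λ i → eq (suc i) λ ())) ⟩
  f 0 ℤ.+ 0ℤ                     ≡⟨ ℤ.+-identityʳ (f 0) ⟩
  f 0                            ∎
∑<-single {suc n} {suc i₀} {f} (s≤s i₀<n) eq = begin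
  f 0 ℤ.+ ∑< n (λ i → f (suc i)) ≡⟨ cong₂ ℤ._+_ (eq 0 λ ()) (∑<-single i₀<n λ i i≢i₀ → eq (suc i) (λ e → i≢i₀ (ℕ.suc-injective e))) ⟩
  0ℤ ℤ.+ f (suc i₀)              ≡⟨ ℤ.+-identityˡ (f (suc i₀)) ⟩
  f (suc i₀)                     ∎

walkSum-∑< : ∀ m n (g : ℕ → Point → ℤ) p →
  walkSum m (λ q → ∑< n (λ i → g i q)) p ≡ ∑< n (λ i → walkSum m (g i) p)
walkSum-∑< m zero    g p = walkSum-0 m p
walkSum-∑< m (suc n) g p = trans (walkSum-+ m (g 0) _ p)
  (cong (λ u → walkSum m (g 0) p ℤ.+ u) (walkSum-∑< m n (λ i → g (suc i)) p))

-- Walk counts as walk sums.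

walk? : ∀ {m} p q (ss : Vec Step m) → Dec (StaysInQuadrant p ss × endpoint p ss ≡ q)
walk? p q ss = staysInQuadrant? p ss ×-dec (endpoint p ss ≟ᴾ q)

-- At `origin` this is `F` by definition; a variable starting point allows induction on the first
-- step.
count : ℕ → Point → Point → ℕ
count m p q = length (filter (walk? p q) (stepSequences m))

module _ {A B : Set} {P : B → Set} {Q : A → Set}
         (P? : ∀ b → Dec (P b)) (Q? : ∀ a → Dec (Q a)) (f : A → B) where
  length-filter-map : (∀ a → does (P? (f a)) ≡ does (Q? a)) → ∀ xs →
    length (filter P? (map f xs)) ≡ length (filter Q? xs)
  length-filter-map eq []       = refl
  length-filter-map eq (x ∷ xs) with does (P? (f x)) | does (Q? x) | eq x
  ... | true  | .true  | refl = cong suc (length-filter-map eq xs)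
  ... | false | .false | refl = length-filter-map eq xs

length-filter-none : ∀ {A : Set} {P : A → Set} (P? : ∀ a → Dec (P a)) →
  (∀ a → ¬ P a) → ∀ xs → length (filter P? xs) ≡ 0
length-filter-none P? ¬P xs = cong length (List.filter-none P? (All.universal ¬P xs))

StaysInQuadrant-head : ∀ {m p} (ss : Vec Step m) → StaysInQuadrant p ss → InQuadrant p
StaysInQuadrant-head Vec.[]       p∈Q       = p∈Q
StaysInQuadrant-head (_ Vec.∷ _) (p∈Q , _) = p∈Q

count-suc : ∀ m p q → InQuadrant p → count (suc m) p q ≡
  count m (move p W) q + (count m (move p NE) q + (count m (move p E) q + count m (move p SW) q))
count-suc m p q p∈Q =
  trans (len-++ (prepend W) _) (cong₂ _+_ (first W)
    (trans (len-++ (prepend NE) _) (cong₂ _+_ (first NE)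
      (trans (len-++ (prepend E) _) (cong₂ _+_ (first E)
        -- The Cartesian product ends in an empty list, appended to the block of the last step.
        (trans (cong len (List.++-identityʳ (prepend SW))) (first SW)))))))
  where
  len : List (Vec Step (suc m)) → ℕ
  len xs = length (filter (walk? p q) xs)
  prepend : Step → List (Vec Step (suc m))
  prepend s = map (s Vec.∷_) (stepSequences m)
  len-++ : ∀ xs ys → len (xs ++ ys) ≡ len xs + len ys
  len-++ xs ys = trans (cong length (List.filter-++ (walk? p q) xs ys)) (List.length-++ (filter (walk? p q) xs))
  first : ∀ s → len (prepend s) ≡ count m (move p s) q
  first s = length-filter-map (walk? p q) (walk? (move p s) q) (s Vec.∷_)
    -- Once the test of `p` is known to be true, the test of the longer sequence computes to that of
    -- its tail.
    (λ ss → cong (λ b → (b ∧ does (staysInQuadrant? (move p s) ss)) ∧ does (endpoint (move p s) ss ≟ᴾ q))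
                 (dec-true (inQuadrant? p) p∈Q))
    (stepSequences m)

count≡walkSum : ∀ m p q → + count m p q ≡ walkSum m (δ q) p
count≡walkSum zero p q with does (inQuadrant? p) | does (p ≟ᴾ q)
... | true  | true  = refl
... | true  | false = refl
... | false | _     = refl
count≡walkSum (suc m) p q with inQuadrant? p
... | no p∉Q = trans
  (cong +_ (length-filter-none (walk? p q)
    (λ { ss (stays , _) → p∉Q (StaysInQuadrant-head ss stays) }) (stepSequences (suc m))))
  (sym (onQuadrant-outside p p∉Q))
... | yes p∈Q = begin
  + count (suc m) p q
    ≡⟨ cong +_ (count-suc m p q p∈Q) ⟩
  stepSum (λ s → + count m (move p s) q)
    ≡⟨ stepSum-cong (λ s → count≡walkSum m (move p s) q) ⟩
  stepSum (λ s → walkSum m (δ q) (move p s))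
    ≡⟨ onQuadrant-inside p p∈Q ⟨
  walkSum (suc m) (δ q) p ∎

-- The last steps of a walk, counted by ballot determinants.

≢-abscissa : ∀ {e s x} → e ℤ.+ (s ℤ.+ s) ≡ x → s ℤ.+ s ≢ 0ℤ → x ≢ e
≢-abscissa {e} {s} {x} eq s+s≢0 x≡e = s+s≢0 (begin
  s ℤ.+ s                      ≡⟨ alg e (s ℤ.+ s) ⟩
  e ℤ.+ (s ℤ.+ s) ℤ.- e        ≡⟨ cong₂ ℤ._-_ (trans eq x≡e) refl ⟩
  e ℤ.- e                      ≡⟨ ℤ.+-inverseʳ e ⟩
  0ℤ                           ∎)
  where
  alg : ∀ e u → u ≡ e ℤ.+ u ℤ.- e
  alg = solve-∀

-- With no steps left the determinant is 1 at `s = 0`, `y = 0` and vanishes otherwise; the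
-- hypothesis makes `s = 0` equivalent to `x = e`.
δ-ballot : ∀ e x y s → e ℤ.+ (s ℤ.+ s) ≡ x → δ (e , 0ℤ) (x , + y) ≡ ballot 0 s (+ y)
δ-ballot e x y       -[1+ k ]  eq = trans
  (δ-≢ (x , + y) (e , 0ℤ) λ p → ≢-abscissa {e} { -[1+ k ]} eq (λ ()) (cong proj₁ p)) (sym (ballot-neg 0 k y))
δ-ballot e x y       (+ suc k) eq = δ-≢ (x , + y) (e , 0ℤ) λ p → ≢-abscissa {e} {+ suc k} eq (λ ()) (cong proj₁ p)
δ-ballot e x (suc y) (+ zero)  eq = δ-≢ (x , + suc y) (e , 0ℤ) λ ()
δ-ballot e x zero    (+ zero)  eq with trans (sym (ℤ.+-identityʳ e)) eq
... | refl = δ-refl (e , 0ℤ)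

-- The equation says that `s` leftward steps among `N` lead from `x` to `e`. A leftward step lowers
-- `s` and `x` together and a rightward one raises `x`, so `s ≤ x` persists; if `x` is negative then
-- so is `s`, and both sides vanish. Heights stop at -1, where both sides vanish too, so the two
-- sides share one recursion and its boundary values.
walkSum-ballot : ∀ N e x y s → s ℤ.≤ x → -1ℤ ℤ.≤ y → e ℤ.+ (s ℤ.+ s) ≡ x ℤ.+ + N →
  walkSum N (δ (e , 0ℤ)) (x , y) ≡ ballot N s y
walkSum-ballot N e x -[1+ zero ] s _ _ _ =
  trans (walkSum-outside N (x , -1ℤ) (λ { (_ , ()) })) (sym (ballot-below N s))
walkSum-ballot N e x -[1+ suc _ ] s _ (-≤- ()) _
walkSum-ballot N e -[1+ j ] (+ y) -[1+ k ] _ _ _ =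
  trans (walkSum-outside N (-[1+ j ] , + y) (λ { (() , _) })) (sym (ballot-neg N k y))
walkSum-ballot N e -[1+ _ ] (+ y) (+ _) () _ _
walkSum-ballot zero e x@(+ _) (+ y) s _ _ eq =
  trans (onQuadrant-inside (x , + y) (+≤+ z≤n , +≤+ z≤n)) (δ-ballot e x y s (trans eq (ℤ.+-identityʳ x)))
walkSum-ballot (suc N) e x@(+ _) y@(+ _) s s≤x _ eq = begin
  walkSum (suc N) d (x , y)
    ≡⟨ onQuadrant-inside (x , y) (+≤+ z≤n , +≤+ z≤n) ⟩
  stepSum (λ st → walkSum N d (move (x , y) st))
    ≡⟨ cong₂ ℤ._+_ (left W refl) (cong₂ ℤ._+_ (right NE refl) (cong₂ ℤ._+_ (right E refl) (left SW refl))) ⟩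
  ballot N (s ℤ.- 1ℤ) (y ℤ.+ 0ℤ) ℤ.+ (ballot N s (y ℤ.+ 1ℤ) ℤ.+
    (ballot N s (y ℤ.+ 0ℤ) ℤ.+ ballot N (s ℤ.- 1ℤ) (y ℤ.- 1ℤ)))
    ≡⟨ cong (λ u → ballot N (s ℤ.- 1ℤ) u ℤ.+ (ballot N s (y ℤ.+ 1ℤ) ℤ.+
         (ballot N s u ℤ.+ ballot N (s ℤ.- 1ℤ) (y ℤ.- 1ℤ)))) (ℤ.+-identityʳ y) ⟩
  ballot N (s ℤ.- 1ℤ) y ℤ.+ (ballot N s (y ℤ.+ 1ℤ) ℤ.+
    (ballot N s y ℤ.+ ballot N (s ℤ.- 1ℤ) (y ℤ.- 1ℤ)))
    ≡⟨ ballot-step N s y ⟨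
  ballot (suc N) s y ∎
  where
  d = δ (e , 0ℤ)
  -1≤dy : ∀ st → -1ℤ ℤ.≤ proj₂ (displacement st)
  -1≤dy W  = -≤+
  -1≤dy NE = -≤+
  -1≤dy E  = -≤+
  -1≤dy SW = -≤- z≤n
  -1≤y : ∀ st → -1ℤ ℤ.≤ y ℤ.+ proj₂ (displacement st)
  -1≤y st = ℤ.+-mono-≤ (+≤+ z≤n) (-1≤dy st)
  eqˡ : e ℤ.+ ((s ℤ.- 1ℤ) ℤ.+ (s ℤ.- 1ℤ)) ≡ x ℤ.- 1ℤ ℤ.+ + N
  eqˡ = begin
    e ℤ.+ ((s ℤ.- 1ℤ) ℤ.+ (s ℤ.- 1ℤ))    ≡⟨ alg₁ e s ⟩
    e ℤ.+ (s ℤ.+ s) ℤ.- (1ℤ ℤ.+ 1ℤ)      ≡⟨ cong (λ u → u ℤ.- (1ℤ ℤ.+ 1ℤ)) eq ⟩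
    x ℤ.+ (1ℤ ℤ.+ + N) ℤ.- (1ℤ ℤ.+ 1ℤ)   ≡⟨ alg₂ x (+ N) ⟩
    x ℤ.- 1ℤ ℤ.+ + N                     ∎
    where
    alg₁ : ∀ e s → e ℤ.+ ((s ℤ.- 1ℤ) ℤ.+ (s ℤ.- 1ℤ)) ≡ e ℤ.+ (s ℤ.+ s) ℤ.- (1ℤ ℤ.+ 1ℤ)
    alg₁ = solve-∀
    alg₂ : ∀ x n → x ℤ.+ (1ℤ ℤ.+ n) ℤ.- (1ℤ ℤ.+ 1ℤ) ≡ x ℤ.- 1ℤ ℤ.+ n
    alg₂ = solve-∀
  left : ∀ st → proj₁ (displacement st) ≡ -1ℤ → walkSum N d (move (x , y) st) ≡
    ballot N (s ℤ.- 1ℤ) (y ℤ.+ proj₂ (displacement st))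
  left st dx rewrite dx = walkSum-ballot N e (x ℤ.- 1ℤ) _ (s ℤ.- 1ℤ)
    (ℤ.+-monoˡ-≤ -1ℤ s≤x) (-1≤y st) eqˡ
  right : ∀ st → proj₁ (displacement st) ≡ 1ℤ → walkSum N d (move (x , y) st) ≡
    ballot N s (y ℤ.+ proj₂ (displacement st))
  right st dx rewrite dx = walkSum-ballot N e (x ℤ.+ 1ℤ) _ s
    (ℤ.≤-trans s≤x (ℤ.i≤i+j x 1ℤ)) (-1≤y st) (trans eq (sym (ℤ.+-assoc x 1ℤ (+ N))))

-- Decomposition at the cut point.

start : ℕ → ℕ → Point
start s t = + 2 ℤ.* + s ℤ.- 1ℤ , + s ℤ.- + t

gridTerm : ℕ → ℕ → ℕ → Point → ℤ
gridTerm N s t q = ballot N (+ s) (+ s ℤ.- + t) ℤ.* δ (start s t) q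

-- The abscissa does not depend on the second argument of `start`; 0 is a placeholder.
start-injective₁ : ∀ {s s′} → proj₁ (start s 0) ≡ proj₁ (start s′ 0) → s ≡ s′
start-injective₁ {s} {s′} eq = ℤ.+-injective (ℤ.*-cancelˡ-≡ (+ 2) (+ s) (+ s′) (begin
  + 2 ℤ.* + s                ≡⟨ i-1+1≡i (+ 2 ℤ.* + s) ⟨
  + 2 ℤ.* + s ℤ.- 1ℤ ℤ.+ 1ℤ  ≡⟨ cong (λ u → u ℤ.+ 1ℤ) eq ⟩
  + 2 ℤ.* + s′ ℤ.- 1ℤ ℤ.+ 1ℤ ≡⟨ i-1+1≡i (+ 2 ℤ.* + s′) ⟩
  + 2 ℤ.* + s′               ∎))

gridTerm-0 : ∀ N s t q → q ≢ start s t → gridTerm N s t q ≡ 0ℤ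
gridTerm-0 N s t q q≢ = trans
  (cong (λ u → ballot N (+ s) (+ s ℤ.- + t) ℤ.* u) (δ-≢ q (start s t) q≢))
  (ℤ.*-zeroʳ (ballot N (+ s) (+ s ℤ.- + t)))

-- If `y ≤ s`, only `t = s ∸ y` meets the point `q`. If `y > s`, no `t` does, and the ballot
-- determinant vanishes as well.
row-sum : ∀ N s y → let q = (proj₁ (start s 0) , + y) in
  ∑< (suc s) (λ t → gridTerm N s t q) ≡ ballot N (+ s) (+ y)
row-sum N s y with ℕ.≤-<-connex y s
... | inj₁ y≤s = begin
  ∑< (suc s) (λ t → gridTerm N s t q)
    ≡⟨ ∑<-single (s≤s (ℕ.m∸n≤m s y)) (λ t t≢t₀ → gridTerm-0 N s t q
         (λ e → t≢t₀ (ℤ.+-injective (begin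
           + t                     ≡⟨ i-[i-j]≡j (+ s) (+ t) ⟨
           + s ℤ.- (+ s ℤ.- + t)   ≡⟨ cong (λ u → + s ℤ.- proj₂ u) e ⟨
           + s ℤ.- + y             ≡⟨ s-y ⟩
           + (s ∸ y)               ∎)))) ⟩
  gridTerm N s (s ∸ y) q
    ≡⟨ cong (λ u → ballot N (+ s) u ℤ.* δ (proj₁ (start s 0) , u) q) s-t₀ ⟩
  ballot N (+ s) (+ y) ℤ.* δ q q
    ≡⟨ cong (λ u → ballot N (+ s) (+ y) ℤ.* u) (δ-refl q) ⟩
  ballot N (+ s) (+ y) ℤ.* 1ℤ
    ≡⟨ ℤ.*-identityʳ (ballot N (+ s) (+ y)) ⟩
  ballot N (+ s) (+ y) ∎
  where
  q = (proj₁ (start s 0) , + y)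
  s-y : + s ℤ.- + y ≡ + (s ∸ y)
  s-y = trans (ℤ.m-n≡m⊖n s y) (ℤ.⊖-≥ y≤s)
  s-t₀ : + s ℤ.- + (s ∸ y) ≡ + y
  s-t₀ = trans (cong (λ u → + s ℤ.- u) (sym s-y)) (i-[i-j]≡j (+ s) (+ y))
... | inj₂ s<y = trans
  (∑<-0 (suc s) λ t → gridTerm-0 N s t q λ e → ℕ.<⇒≱ s<y (above t (cong proj₂ e)))
  (sym (trans (cong (λ u → ballot N (+ s) (+ u)) (sym (ℕ.m+[n∸m]≡n s<y))) (ballot-high N s (y ∸ suc s))))
  where
  q = (proj₁ (start s 0) , + y)
  above : ∀ t → + y ≡ + s ℤ.- + t → y ≤ s
  above t e = ℤ.drop‿+≤+ (subst (ℤ._≤ + s) (sym e) (ℤ.i-j≤i (+ s) (+ t)))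

-- The ballot determinant as a combination of point masses at the cut points, with `s = suc i`;
-- linearity of `walkSum` then yields the double sum.
gridSum : ℕ → ℕ → Point → ℤ
gridSum N k q = ∑< k λ i → ∑< (2 + i) λ t → gridTerm N (suc i) t q

grid-sum : ∀ N k i y → i < k → gridSum N k (proj₁ (start (suc i) 0) , + y) ≡ ballot N (+ suc i) (+ y)
grid-sum N k i y i<k = trans
  (∑<-single i<k λ j j≢i → ∑<-0 (2 + j) λ t → gridTerm-0 N (suc j) t q
    λ e → j≢i (ℕ.suc-injective (sym (start-injective₁ (cong proj₁ e)))))
  (row-sum N (suc i) y)
  where
  q = (proj₁ (start (suc i) 0) , + y)

walkSum≡gridSum : ∀ n k i y → i < k → let q = (proj₁ (start (suc i) 0) , + y) in
  walkSum (suc n) (δ (+ n , 0ℤ)) q ≡ gridSum (suc n) k q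
walkSum≡gridSum n k i y i<k = trans
  (walkSum-ballot (suc n) (+ n) _ (+ y) (+ suc i) s≤x -≤+ (alg (+ n) (+ suc i)))
  (sym (grid-sum (suc n) k i y i<k))
  where
  alg : ∀ n s → n ℤ.+ (s ℤ.+ s) ≡ (1ℤ ℤ.+ 1ℤ) ℤ.* s ℤ.- 1ℤ ℤ.+ (1ℤ ℤ.+ n)
  alg = solve-∀
  alg₂ : ∀ i → (1ℤ ℤ.+ i) ℤ.+ i ≡ (1ℤ ℤ.+ 1ℤ) ℤ.* (1ℤ ℤ.+ i) ℤ.- 1ℤ
  alg₂ = solve-∀
  s≤x : + suc i ℤ.≤ + 2 ℤ.* + suc i ℤ.- 1ℤ
  -- `2s - 1 = s + i` with `i = s - 1`: here `s ≥ 1` is what makes `s ≤ x` hold.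
  s≤x = subst (+ suc i ℤ.≤_) (alg₂ (+ i)) (ℤ.i≤i+j (+ suc i) (+ i))

walk-decomposition : ∀ n k m → + m ≡ + 2 ℤ.* + suc k ℤ.- 1ℤ →
  walkSum (m + suc n) (δ (+ n , 0ℤ)) origin ≡
  ∑< (suc k) λ i → ∑< (2 + i) λ t →
    ballot (suc n) (+ suc i) (+ suc i ℤ.- + t) ℤ.* walkSum m (δ (start (suc i) t)) origin
walk-decomposition n k m m≡ = begin
  walkSum (m + suc n) (δ (+ n , 0ℤ)) origin
    ≡⟨ walkSum-++ m (suc n) (δ (+ n , 0ℤ)) origin ⟩
  walkSum m (walkSum (suc n) (δ (+ n , 0ℤ))) origin
    ≡⟨ walkSum-cong m origin on-grid ⟩
  walkSum m (gridSum (suc n) (suc k)) origin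
    ≡⟨ walkSum-∑< m (suc k) (λ i q → ∑< (2 + i) λ t → gridTerm (suc n) (suc i) t q) origin ⟩
  ∑< (suc k) (λ i → walkSum m (λ q → ∑< (2 + i) λ t → gridTerm (suc n) (suc i) t q) origin)
    ≡⟨ ∑<-cong (suc k) (λ i → walkSum-∑< m (2 + i) (λ t → gridTerm (suc n) (suc i) t) origin) ⟩
  ∑< (suc k) (λ i → ∑< (2 + i) λ t → walkSum m (gridTerm (suc n) (suc i) t) origin)
    ≡⟨ ∑<-cong (suc k) (λ i → ∑<-cong (2 + i) λ t → walkSum-* m (ballot (suc n) (+ suc i) (+ suc i ℤ.- + t)) (δ (start (suc i) t)) origin) ⟩
  ∑< (suc k) (λ i → ∑< (2 + i) λ t →
    ballot (suc n) (+ suc i) (+ suc i ℤ.- + t) ℤ.* walkSum m (δ (start (suc i) t)) origin) ∎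
  where
  near : ∀ l i → 0ℤ ℤ.+ ((1ℤ ℤ.+ 1ℤ) ℤ.* (1ℤ ℤ.+ (l ℤ.+ i)) ℤ.- 1ℤ) ℤ.- (l ℤ.+ l) ≡
    (1ℤ ℤ.+ 1ℤ) ℤ.* (1ℤ ℤ.+ i) ℤ.- 1ℤ
  near = solve-∀
  far : ∀ k j → 0ℤ ℤ.+ ((1ℤ ℤ.+ 1ℤ) ℤ.* (1ℤ ℤ.+ k) ℤ.- 1ℤ) ℤ.- ((1ℤ ℤ.+ k ℤ.+ j) ℤ.+ (1ℤ ℤ.+ k ℤ.+ j)) ≡
    ℤ.- (1ℤ ℤ.+ (j ℤ.+ j))
  far = solve-∀
  -- After `m` steps, `l` of them leftward, the abscissa is `2s - 1` with `s = suc k - l`. If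
  -- `l ≤ k` this is a row of the grid, with index `k ∸ l`; if `l > k` the abscissa is negative,
  -- outside the quadrant.
  on-grid : ∀ l q → InQuadrant q → proj₁ q ≡ 0ℤ ℤ.+ + m ℤ.- (+ l ℤ.+ + l) →
    walkSum (suc n) (δ (+ n , 0ℤ)) q ≡ gridSum (suc n) (suc k) q
  on-grid l (x , + y) (0≤x , _) qx rewrite m≡ with ℕ.≤-<-connex l k
  ... | inj₁ l≤k = subst (λ u → walkSum (suc n) (δ (+ n , 0ℤ)) (u , + y) ≡ gridSum (suc n) (suc k) (u , + y))
    (sym x≡) (walkSum≡gridSum n (suc k) (k ∸ l) y (s≤s (ℕ.m∸n≤m k l)))
    where
    x≡ : x ≡ proj₁ (start (suc (k ∸ l)) 0)
    x≡ = trans qx (trans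
      (cong (λ u → 0ℤ ℤ.+ (+ 2 ℤ.* + suc u ℤ.- 1ℤ) ℤ.- (+ l ℤ.+ + l)) (sym (ℕ.m+[n∸m]≡n l≤k)))
      (near (+ l) (+ (k ∸ l))))
  ... | inj₂ k<l = contradiction (subst (0ℤ ℤ.≤_) x≡ 0≤x) λ ()
    where
    x≡ : x ≡ -[1+ (l ∸ suc k) + (l ∸ suc k) ]
    x≡ = trans qx (trans
      (cong (λ u → 0ℤ ℤ.+ (+ 2 ℤ.* + suc k ℤ.- 1ℤ) ℤ.- (+ u ℤ.+ + u)) (sym (ℕ.m+[n∸m]≡n k<l)))
      (far (+ k) (+ (l ∸ suc k))))

-- Passage from integers to rationals.

fromℚᵘ-homo-+ : ∀ p q → ℚ.fromℚᵘ (p ℚᵘ.+ q) ≡ ℚ.fromℚᵘ p ℚ.+ ℚ.fromℚᵘ q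
fromℚᵘ-homo-+ p q = ℚ.toℚᵘ-injective (ℚᵘ.≃-trans (ℚ.toℚᵘ-fromℚᵘ (p ℚᵘ.+ q)) (ℚᵘ.≃-sym
  (ℚᵘ.≃-trans (ℚ.toℚᵘ-homo-+ (ℚ.fromℚᵘ p) (ℚ.fromℚᵘ q))
    (ℚᵘ.+-cong (ℚ.toℚᵘ-fromℚᵘ p) (ℚ.toℚᵘ-fromℚᵘ q)))))

fromℚᵘ-homo-* : ∀ p q → ℚ.fromℚᵘ (p ℚᵘ.* q) ≡ ℚ.fromℚᵘ p ℚ.* ℚ.fromℚᵘ q
fromℚᵘ-homo-* p q = ℚ.toℚᵘ-injective (ℚᵘ.≃-trans (ℚ.toℚᵘ-fromℚᵘ (p ℚᵘ.* q)) (ℚᵘ.≃-sym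
  (ℚᵘ.≃-trans (ℚ.toℚᵘ-homo-* (ℚ.fromℚᵘ p) (ℚ.fromℚᵘ q))
    (ℚᵘ.*-cong (ℚ.toℚᵘ-fromℚᵘ p) (ℚ.toℚᵘ-fromℚᵘ q)))))

fromℤ : ℤ → ℚ
fromℤ i = i / 1

fromℤ-+ : ∀ i j → fromℤ (i ℤ.+ j) ≡ fromℤ i ℚ.+ fromℤ j
fromℤ-+ i j = trans
  -- The unnormalised sum has numerator `i * 1 + j * 1`.
  (cong₂ (λ u v → fromℤ (u ℤ.+ v)) (sym (ℤ.*-identityʳ i)) (sym (ℤ.*-identityʳ j)))
  (fromℚᵘ-homo-+ (mkℚᵘ i 0) (mkℚᵘ j 0))

fromℤ-∑< : ∀ n (f : ℕ → ℤ) (g : ℕ → ℚ) → (∀ i → fromℤ (f i) ≡ g i) →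
  fromℤ (∑< n f) ≡ foldr ℚ._+_ ℚ.0ℚ (applyUpTo g n)
fromℤ-∑< zero    f g eq = refl
fromℤ-∑< (suc n) f g eq = trans (fromℤ-+ (f 0) (∑< n λ i → f (suc i)))
  (cong₂ ℚ._+_ (eq 0) (fromℤ-∑< n (λ i → f (suc i)) (λ i → g (suc i)) (λ i → eq (suc i))))

-- Only one factor has a nontrivial denominator, so a single cross-multiplication of unnormalised
-- fractions reduces the claim to the integer hypothesis.
fraction-* : ∀ d a b c x y → + suc d ℤ.* x ≡ a ℤ.* b ℤ.* c →
  fromℤ (x ℤ.* y) ≡ (a / suc d) ℚ.* fromℤ b ℚ.* fromℤ c ℚ.* fromℤ y
fraction-* d a b c x y eq = begin
  fromℤ (x ℤ.* y)
    ≡⟨ ℚ.fromℚᵘ-cong {mkℚᵘ (x ℤ.* y) 0} {r ℚᵘ.* s ℚᵘ.* t ℚᵘ.* u} (*≡* cross) ⟩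
  ℚ.fromℚᵘ (r ℚᵘ.* s ℚᵘ.* t ℚᵘ.* u)
    ≡⟨ fromℚᵘ-homo-* (r ℚᵘ.* s ℚᵘ.* t) u ⟩
  ℚ.fromℚᵘ (r ℚᵘ.* s ℚᵘ.* t) ℚ.* fromℤ y
    ≡⟨ cong (ℚ._* fromℤ y) (fromℚᵘ-homo-* (r ℚᵘ.* s) t) ⟩
  ℚ.fromℚᵘ (r ℚᵘ.* s) ℚ.* fromℤ c ℚ.* fromℤ y
    ≡⟨ cong (λ z → z ℚ.* fromℤ c ℚ.* fromℤ y) (fromℚᵘ-homo-* r s) ⟩
  (a / suc d) ℚ.* fromℤ b ℚ.* fromℤ c ℚ.* fromℤ y ∎
  where
  r = mkℚᵘ a d
  s = mkℚᵘ b 0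
  t = mkℚᵘ c 0
  u = mkℚᵘ y 0
  alg : ∀ d x y → x ℤ.* y ℤ.* d ≡ d ℤ.* x ℤ.* y
  alg = solve-∀
  cross : x ℤ.* y ℤ.* ℚᵘ.↧ (r ℚᵘ.* s ℚᵘ.* t ℚᵘ.* u) ≡ a ℤ.* b ℤ.* c ℤ.* y ℤ.* 1ℤ
  cross = begin
    x ℤ.* y ℤ.* + (suc d * 1 * 1 * 1)
      ≡⟨ cong (λ z → x ℤ.* y ℤ.* + z) (trans (ℕ.*-identityʳ (suc d * 1 * 1))
           (trans (ℕ.*-identityʳ (suc d * 1)) (ℕ.*-identityʳ (suc d)))) ⟩
    x ℤ.* y ℤ.* + suc d
      ≡⟨ alg (+ suc d) x y ⟩
    + suc d ℤ.* x ℤ.* y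
      ≡⟨ cong (ℤ._* y) eq ⟩
    a ℤ.* b ℤ.* c ℤ.* y
      ≡⟨ ℤ.*-identityʳ (a ℤ.* b ℤ.* c ℤ.* y) ⟨
    a ℤ.* b ℤ.* c ℤ.* y ℤ.* 1ℤ ∎

theorem5 : ∀ (n k : ℕ) → 1 ≤ k →
    fromℕ (F (n + 2 * k) (+ n) 0ℤ)
    ≡ ∑[ s from 1 to k ] ∑[ t from 0 to s ]
    ((+ s ℤ.- + t ℤ.+ 1ℤ) / (2 + n))
    ℚ.* fromℕ ((2 + n) C (s + 1))
    ℚ.* fromℕ ((2 + n) C t)
    ℚ.* fromℕ (F (2 * k ∸ 1) (+ 2 ℤ.* + s ℤ.- 1ℤ) (+ s ℤ.- + t))
theorem5 n (suc k) _ = begin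
  fromℕ (F (n + 2 * suc k) (+ n) 0ℤ)
    ≡⟨ cong (λ l → fromℕ (F l (+ n) 0ℤ)) length-split ⟩
  fromℤ (+ count (m + suc n) origin (+ n , 0ℤ))
    ≡⟨ cong fromℤ (count≡walkSum (m + suc n) origin (+ n , 0ℤ)) ⟩
  fromℤ (walkSum (m + suc n) (δ (+ n , 0ℤ)) origin)
    ≡⟨ cong fromℤ (walk-decomposition n k m refl) ⟩
  fromℤ (∑< (suc k) λ i → ∑< (2 + i) (term i))
    -- The outer sum starts at 1, so index `i` stands for `s = suc i`, and `t` from 0 to `s` takes
    -- `2 + i` values.
    ≡⟨ fromℤ-∑< (suc k) (λ i → ∑< (2 + i) (term i)) (λ i → ∑[ t from 0 to suc i ] summand i t)
         (λ i → fromℤ-∑< (2 + i) (term i) (summand i) (fromℤ-term i)) ⟩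
  ∑[ s from 1 to suc k ] ∑[ t from 0 to s ]
    ((+ s ℤ.- + t ℤ.+ 1ℤ) / (2 + n))
    ℚ.* fromℕ ((2 + n) C (s + 1))
    ℚ.* fromℕ ((2 + n) C t)
    ℚ.* fromℕ (F m (+ 2 ℤ.* + s ℤ.- 1ℤ) (+ s ℤ.- + t)) ∎
  where
  m = 2 * suc k ∸ 1
  H term : ℕ → ℕ → ℤ
  H i t = ballot (suc n) (+ suc i) (+ suc i ℤ.- + t)
  term i t = H i t ℤ.* walkSum m (δ (start (suc i) t)) origin
  summand : ℕ → ℕ → ℚ
  summand i t =
    ((+ suc i ℤ.- + t ℤ.+ 1ℤ) / (2 + n))
    ℚ.* fromℕ ((2 + n) C (suc i + 1))
    ℚ.* fromℕ ((2 + n) C t)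
    ℚ.* fromℕ (F m (+ 2 ℤ.* + suc i ℤ.- 1ℤ) (+ suc i ℤ.- + t))
  length-split : n + 2 * suc k ≡ m + suc n
  -- `2 * suc k` computes to `suc m`, so the unit removed from the first piece lengthens the second
  -- to `suc n`.
  length-split = trans (ℕ.+-suc n m) (trans (cong suc (ℕ.+-comm n m)) (sym (ℕ.+-suc m n)))
  fromℤ-term : ∀ i t → fromℤ (term i t) ≡ summand i t
  fromℤ-term i t = trans
    (cong (λ u → fromℤ (H i t ℤ.* u)) (sym (count≡walkSum m origin (start (suc i) t))))
    (fraction-* (suc n) (+ suc i ℤ.- + t ℤ.+ 1ℤ)
      (+ ((2 + n) C (suc i + 1))) (+ ((2 + n) C t)) (H i t) (+ count m origin (start (suc i) t))
      -- The last piece has `suc n` steps, whence the denominator and upper indices `2 + n`.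
      (ballot-closed (suc n) (+ suc i) (+ t)))
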